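{- Let $\mathcal T_1=(S_1,\Sigma_1,\kappa_1)$ and $\mathcal T_2=(S_2,\Sigma_2,\kappa_2)$ be stochastic transition systems, $\alpha:(S_1,\Sigma_1)\to(S_2,\Sigma_2)$ a measurable function, and $\mu\in\mathrm{Dist}(S_1)$. If $\mathcal T_2$ is a $\mu$-sound $\alpha$-abstraction of $\mathcal T_1$, then for every $B\in\Sigma_2$: if $\mathcal T_2$ is decisive w.r.t. $B$ from $\alpha_\#(\mu)$, then $\mathcal T_1$ is decisive w.r.t. $\alpha^{ -1}(B)$ from $\mu$.
   Context: A stochastic transition system (STS) is $\mathcal T=(S,\Sigma,\kappa)$ where $(S,\Sigma)$ is a measurable space and $\kappa:S\times\Sigma\to[0,1]$ is a Markov kernel. $\mathrm{Dist}(S)$ is the set of probability measures on $(S,\Sigma)$; $\delta_s$ is the Dirac measure at $s$. For $\mu\in\mathrm{Dist}(S)$, $\mathrm{Prob}^{\mathcal T}_\mu$ is the law on infinite paths $s_0s_1\dots\in S^\omega$ (cylinder $\sigma$-algebra) of the Markov chain with initial distribution $\mu$ and kernel $\kappa$. $\mathbf F B$ is the event $\exists i\ge0,\ s_i\in B$. The avoid-set of $B\in\Sigma$ is $\widetilde B=\{s\in S\mid\mathrm{Prob}^{\mathcal T}_{\delta_s}(\mathbf F B)=0\}$ (a measurable set). $\mathcal T$ is decisive w.r.t. $B$ from $\mu$ if $\mathrm{Prob}^{\mathcal T}_\mu(\mathbf F B\vee\mathbf F\widetilde B)=1$. $\Omega_{\mathcal T}(\mu)\in\mathrm{Dist}(S)$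 is defined by $\Omega_{\mathcal T}(\mu)(A)=\int_S\kappa(s,A)\,\mu(\mathrm ds)$. The pushforward $\alpha_\#:\mathrm{Dist}(S_1)\to\mathrm{Dist}(S_2)$ is $\alpha_\#(\mu)(M)=\mu(\alpha^{ -1}(M))$. $\mathcal T_2$ is an $\alpha$-abstraction of $\mathcal T_1$ if for every $\mu\in\mathrm{Dist}(S_1)$ the measures $\alpha_\#(\Omega_{\mathcal T_1}(\mu))$ and $\Omega_{\mathcal T_2}(\alpha_\#(\mu))$ have the same null sets. It is $\mu$-sound if for every $B\in\Sigma_2$: $\mathrm{Prob}^{\mathcal T_2}_{\alpha_\#(\mu)}(\mathbf F B)=1$ implies $\mathrm{Prob}^{\mathcal T_1}_\mu(\mathbf F\alpha^{ -1}(B))=1$. -}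

module Defs where

open import Axiom.ExcludedMiddle using (ExcludedMiddle)
open import Data.Empty using (⊥-elim)
open import Data.Integer.Base using (+[1+_]; -[1+_]; +≤+; +<+)
  renaming (+_ to pos)
import Data.Integer.Properties as ℤ
open import Data.List.Base using (List; []; _∷_)
open import Data.Nat.Coprimality using (1-coprimeTo)
open import Data.Nat.Base as ℕ using (ℕ; zero; suc)
import Data.Nat.Properties as ℕ
open import Data.Product.Base using (Σ; ∃; ∃₂; _×_; _,_; proj₁; swap)
open import Data.Rational.Base as ℚ
  using (ℚ; mkℚ; 0ℚ; 1ℚ; ½; _<_; _≤_; _+_; _*_; _-_; -_; *<*; *≤*)
import Data.Rational.Properties as ℚ
open import Data.Sum.Base using (_⊎_; inj₁; inj₂; [_,_]′)
open import Data.Unit.Base using (tt)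
open import Function.Base using (_∘_; id)
open import Function.Bundles using (_⇔_; mk⇔; module Equivalence)
open import Level using (Level; 0ℓ; _⊔_) renaming (suc to lsuc)
open import Relation.Binary.Definitions using (tri<; tri≈; tri>)
open import Relation.Binary.PropositionalEquality
  using (_≡_; _≢_; refl; sym; trans; cong; subst)
open import Relation.Nullary using (¬_; Dec; yes; no)
open import Relation.Nullary.Decidable using (True; toWitness; fromWitness)
open import Relation.Unary
  using (Pred; _∈_; _∉_; _⊆_; _≐_; _∩_; _∪_; ∁; ∅; U; ⋃; _⊢_; _⊥_)

private variable
  a b m m₁ m₂ g : Level

-- A number x ∈ [0,∞] is the set { q ∈ ℚ | q < x }, an open lower cut.
-- Classically every such number arises this way; ∞ is all of ℚ.
record ℝ≥0∞ : Set₁ where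
  field
    cut      : Pred ℚ 0ℓ
    negative : ∀ {q} → q < 0ℚ → q ∈ cut
    down     : ∀ {p q} → p < q → q ∈ cut → p ∈ cut
    open′    : ∀ {q} → q ∈ cut → ∃ λ p → q < p × p ∈ cut

open ℝ≥0∞ public

infix 4 _≤ʳ_ _<ʳ_ _≈_
infixl 6 _+ʳ_
infixl 7 _*ʳ_

_≤ʳ_ _<ʳ_ : ℝ≥0∞ → ℝ≥0∞ → Set
x ≤ʳ y = cut x ⊆ cut y
x <ʳ y = ∃ λ q → q ∈ cut y × q ∉ cut x

record _≈_ (x y : ℝ≥0∞) : Set where
  constructor _,_
  field
    ≤-incl : x ≤ʳ y
    ≥-incl : y ≤ʳ x

open _≈_ public

≈-trans : ∀ {x y z} → x ≈ y → y ≈ z → x ≈ z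
≈-trans (x≤y , y≤x) (y≤z , z≤y) = y≤z ∘ x≤y , y≤x ∘ z≤y

≈-sym : ∀ {x y} → x ≈ y → y ≈ x
≈-sym (x≤y , y≤x) = y≤x , x≤y

fromℚ : ℚ → ℝ≥0∞
fromℚ r = record
  { cut      = λ q → q < 0ℚ ⊎ q < r
  ; negative = inj₁
  ; down     = λ p<q → λ where
      (inj₁ q<0) → inj₁ (ℚ.<-trans p<q q<0)
      (inj₂ q<r) → inj₂ (ℚ.<-trans p<q q<r)
  ; open′    = λ where
      (inj₁ q<0) → let p , q<p , p<0 = ℚ.<-dense q<0 in p , q<p , inj₁ p<0
      (inj₂ q<r) → let p , q<p , p<r = ℚ.<-dense q<r in p , q<p , inj₂ p<r
  }

0ʳ 1ʳ : ℝ≥0∞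
0ʳ = fromℚ 0ℚ
1ʳ = fromℚ 1ℚ

_+ʳ_ : ℝ≥0∞ → ℝ≥0∞ → ℝ≥0∞
x +ʳ y = record
  { cut      = λ q → ∃₂ λ a b → a ∈ cut x × b ∈ cut y × q ≤ a + b
  ; negative = λ {q} q<0 →
      let s = q * ½
          s<0 = subst (s <_) (ℚ.*-zeroˡ ½) (ℚ.*-monoˡ-<-pos ½ q<0)
      in s , s , negative x s<0 , negative y s<0 ,
         ℚ.≤-reflexive (trans (sym (ℚ.*-identityʳ q)) (ℚ.*-distribˡ-+ q ½ ½))
  ; down     = λ p<q (a , b , a∈x , b∈y , q≤) →
      a , b , a∈x , b∈y , ℚ.≤-trans (ℚ.<⇒≤ p<q) q≤
  ; open′    = λ (a , b , a∈x , b∈y , q≤) →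
      let a′ , a<a′ , a′∈x = open′ x a∈x in
      a′ + b , ℚ.≤-<-trans q≤ (ℚ.+-monoˡ-< b a<a′) ,
      a′ , b , a′∈x , b∈y , ℚ.≤-refl
  }

-- With this definition 0 · ∞ = 0.
_*ʳ_ : ℝ≥0∞ → ℝ≥0∞ → ℝ≥0∞
x *ʳ y = record
  { cut      = λ q → q < 0ℚ ⊎
      ∃₂ λ a b → a ∈ cut x × b ∈ cut y × 0ℚ ≤ a × 0ℚ ≤ b × q < a * b
  ; negative = inj₁
  ; down     = λ p<q → λ where
      (inj₁ q<0) → inj₁ (ℚ.<-trans p<q q<0)
      (inj₂ (a , b , a∈ , b∈ , 0≤a , 0≤b , q<)) →
        inj₂ (a , b , a∈ , b∈ , 0≤a , 0≤b , ℚ.<-trans p<q q<)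
  ; open′    = λ where
      (inj₁ q<0) → let p , q<p , p<0 = ℚ.<-dense q<0 in p , q<p , inj₁ p<0
      (inj₂ (a , b , a∈ , b∈ , 0≤a , 0≤b , q<)) →
        let p , q<p , p< = ℚ.<-dense q< in
        p , q<p , inj₂ (a , b , a∈ , b∈ , 0≤a , 0≤b , p<)
  }

-- x when P is x if P holds and 0 otherwise.
_when_ : ℝ≥0∞ → Set → ℝ≥0∞
x when P = record
  { cut      = λ q → q < 0ℚ ⊎ (P × q ∈ cut x)
  ; negative = inj₁
  ; down     = λ p<q → λ where
      (inj₁ q<0)       → inj₁ (ℚ.<-trans p<q q<0)
      (inj₂ (h , q∈x)) → inj₂ (h , down x p<q q∈x)
  ; open′    = λ where
      (inj₁ q<0)       →
        let p , q<p , p<0 = ℚ.<-dense q<0 in p , q<p , inj₁ p<0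
      (inj₂ (h , q∈x)) →
        let p , q<p , p∈x = open′ x q∈x in p , q<p , inj₂ (h , p∈x)
  }

⨆ : (ℕ → ℝ≥0∞) → ℝ≥0∞
⨆ x = record
  { cut      = λ q → ∃ λ n → q ∈ cut (x n)
  ; negative = λ q<0 → 0 , negative (x 0) q<0
  ; down     = λ p<q (n , q∈) → n , down (x n) p<q q∈
  ; open′    = λ (n , q∈) →
      let p , q<p , p∈ = open′ (x n) q∈ in p , q<p , n , p∈
  }

partialSum : (ℕ → ℝ≥0∞) → ℕ → ℝ≥0∞
partialSum x zero    = 0ʳ
partialSum x (suc n) = partialSum x n +ʳ x n

∑ : (ℕ → ℝ≥0∞) → ℝ≥0∞
∑ x = ⨆ (partialSum x)

+-incl₂ : ∀ x {y} → y ≤ʳ x +ʳ y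
+-incl₂ x {y} {q} q∈y = let p , q<p , p∈y = open′ y q∈y in
  q - p , p ,
  negative x (subst (q - p <_) (ℚ.+-inverseʳ p) (ℚ.+-monoˡ-< (- p) q<p)) ,
  p∈y , ℚ.≤-reflexive (sym (trans (ℚ.+-assoc q (- p) p)
    (trans (cong (q +_) (ℚ.+-inverseˡ p)) (ℚ.+-identityʳ q))))

+-incl₁ : ∀ x {y} → x ≤ʳ x +ʳ y
+-incl₁ x {y} q∈x =
  let b , a , b∈ , a∈ , q≤ = +-incl₂ y {x} q∈x
  in a , b , a∈ , b∈ , subst (_ ≤_) (ℚ.+-comm b a) q≤

term≤∑ : ∀ x n → x n ≤ʳ ∑ x
term≤∑ x n q∈ = suc n , +-incl₂ (partialSum x n) {x n} q∈

zero-intro : ∀ {x} → (∀ {q} → q ∈ cut x → q < 0ℚ) → x ≈ 0ʳ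
zero-intro {x} h = (λ q∈ → inj₁ (h q∈)) , λ where
  (inj₁ q<0) → negative x q<0
  (inj₂ q<0) → negative x q<0

zero-elim : ∀ {x} → x ≈ 0ʳ → ∀ {q} → q ∈ cut x → q < 0ℚ
zero-elim x≈0 q∈ = [ id , id ]′ (≤-incl x≈0 q∈)

≤-zero : ∀ {x y} → x ≤ʳ y → y ≈ 0ʳ → x ≈ 0ʳ
≤-zero x≤y y≈0 = zero-intro (λ q∈ → zero-elim y≈0 (x≤y q∈))

+-zero : ∀ {x y} → x ≈ 0ʳ → y ≈ 0ʳ → x +ʳ y ≈ 0ʳ
+-zero x≈0 y≈0 = zero-intro λ (a , b , a∈ , b∈ , q≤) →
  ℚ.≤-<-trans q≤ (ℚ.+-mono-< (zero-elim x≈0 a∈) (zero-elim y≈0 b∈))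

∑-zero : ∀ {x} → (∀ n → x n ≈ 0ʳ) → ∑ x ≈ 0ʳ
∑-zero {x} h = zero-intro λ (n , q∈) → zero-elim (partial n) q∈
  where
  partial : ∀ n → partialSum x n ≈ 0ʳ
  partial zero    = id , id
  partial (suc n) = +-zero (partial n) (h n)

ℚ-absurd : ∀ {p} {A : Set} → p < 0ℚ → 0ℚ ≤ p → A
ℚ-absurd p<0 0≤p = ⊥-elim (ℚ.<-irrefl refl (ℚ.<-≤-trans p<0 0≤p))

*-zeroˡ : ∀ {x y} → x ≈ 0ʳ → x *ʳ y ≈ 0ʳ
*-zeroˡ x≈0 = zero-intro λ where
  (inj₁ q<0) → q<0
  (inj₂ (a , b , a∈ , b∈ , 0≤a , _)) →
    ℚ-absurd (zero-elim x≈0 a∈) 0≤a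

*-zeroʳ : ∀ {x y} → y ≈ 0ʳ → x *ʳ y ≈ 0ʳ
*-zeroʳ y≈0 = zero-intro λ where
  (inj₁ q<0) → q<0
  (inj₂ (a , b , a∈ , b∈ , _ , 0≤b , _)) →
    ℚ-absurd (zero-elim y≈0 b∈) 0≤b

ε : ℕ → ℚ
ε n = mkℚ (pos 1) n (1-coprimeTo (suc n))

0<ε : ∀ n → 0ℚ < ε n
0<ε n = ℚ.positive⁻¹ (ε n)

archimedean : ∀ p → 0ℚ < p → ∃ λ n → ε n ≤ p
archimedean p@(mkℚ +[1+ n ] d _) _ =
  d , *≤* (ℤ.*-monoʳ-≤-nonNeg (pos (suc d)) {pos 1} {+[1+ n ]} (+≤+ (ℕ.s≤s ℕ.z≤n)))
archimedean (mkℚ (pos 0) d _) (*<* (+<+ ()))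
archimedean (mkℚ -[1+ n ] d _) (*<* ())

-- A positive multiple of a non-zero number is non-zero.
*-cancel-zero : ∀ n {y} → fromℚ (ε n) *ʳ y ≈ 0ʳ → y ≈ 0ʳ
*-cancel-zero n {y} ≈0 = zero-intro λ {q} q∈ →
  [ id , (λ 0≤q → ⊥-elim (absurd 0≤q q∈)) ]′ (split q)
  where
  split : ∀ q → q < 0ℚ ⊎ 0ℚ ≤ q
  split q with q ℚ.<? 0ℚ
  ... | yes q<0 = inj₁ q<0
  ... | no  q≮0 = inj₂ (ℚ.≮⇒≥ q≮0)
  absurd : ∀ {q} → 0ℚ ≤ q → ¬ q ∈ cut y
  absurd 0≤q q∈ =
    let p , q<p , p∈ = open′ y q∈
        a , 0<a , a<ε = ℚ.<-dense (0<ε n)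
        0<p = ℚ.≤-<-trans 0≤q q<p
    in ℚ.<-irrefl refl (zero-elim ≈0 {0ℚ} (inj₂ (a , p , inj₂ a<ε , p∈ ,
         ℚ.<⇒≤ 0<a , ℚ.<⇒≤ 0<p , 0<* 0<a 0<p)))
    where
    0<* : ∀ {a b} → 0ℚ < a → 0ℚ < b → 0ℚ < a * b
    0<* {a} {b} 0<a 0<b =
      subst (_< a * b) (ℚ.*-zeroˡ b) (ℚ.*-monoˡ-<-pos b {{ℚ.positive 0<b}} 0<a)

-- Subsets are predicates with values in Set₀; under excluded middle this
-- is the full power set, whatever the level of the carrier.
record MeasurableSpace (a m : Level) : Set (lsuc (a ⊔ m ⊔ lsuc 0ℓ)) where
  field
    Carrier    : Set a
    Measurable : Pred (Pred Carrier 0ℓ) m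
    resp       : ∀ {A B} → A ≐ B → Measurable A → Measurable B
    empty      : Measurable ∅
    compl      : ∀ {A} → Measurable A → Measurable (∁ A)
    union      : ∀ {A : ℕ → Pred Carrier 0ℓ} →
                 (∀ n → Measurable (A n)) → Measurable (⋃ ℕ A)

open MeasurableSpace public

record Event (M : MeasurableSpace a m) : Set (a ⊔ m ⊔ lsuc 0ℓ) where
  constructor event
  field
    set        : Pred (Carrier M) 0ℓ
    measurable : Measurable M set

open Event public

module _ {M : MeasurableSpace a m} where

  infixr 6 _∪ᵉ_

  ∅ᵉ Uᵉ : Event M
  ∅ᵉ = event ∅ (empty M)
  Uᵉ = event U (resp M ((λ _ → tt) , λ _ ()) (compl M (empty M)))

  ∁ᵉ : Event M → Event M
  ∁ᵉ A = event (∁ (set A)) (compl M (measurable A))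

  ⋃ᵉ : (ℕ → Event M) → Event M
  ⋃ᵉ A = event (⋃ ℕ (set ∘ A)) (union M (measurable ∘ A))

  _∪ᵉ_ : Event M → Event M → Event M
  A ∪ᵉ B = event (set A ∪ set B) (resp M (to , from) (measurable (⋃ᵉ sequence)))
    where
    sequence : ℕ → Event M
    sequence zero    = A
    sequence (suc _) = B
    to : set (⋃ᵉ sequence) ⊆ set A ∪ set B
    to (zero  , x∈A) = inj₁ x∈A
    to (suc _ , x∈B) = inj₂ x∈B
    from : set A ∪ set B ⊆ set (⋃ᵉ sequence)
    from (inj₁ x∈A) = 0 , x∈A
    from (inj₂ x∈B) = 1 , x∈B

data Generated {X : Set a} (G : Pred (Pred X 0ℓ) g) :
               Pred (Pred X 0ℓ) (lsuc 0ℓ ⊔ a ⊔ g) where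
  gen       : ∀ {A} → G A → Generated G A
  gen-resp  : ∀ {A B} → A ≐ B → Generated G A → Generated G B
  gen-empty : Generated G ∅
  gen-compl : ∀ {A} → Generated G A → Generated G (∁ A)
  gen-union : ∀ {A : ℕ → Pred X 0ℓ} →
              (∀ n → Generated G (A n)) → Generated G (⋃ ℕ A)

generate : {X : Set a} → Pred (Pred X 0ℓ) g →
           MeasurableSpace a (lsuc 0ℓ ⊔ a ⊔ g)
generate {X = X} G = record
  { Carrier    = X
  ; Measurable = Generated G
  ; resp       = gen-resp
  ; empty      = gen-empty
  ; compl      = gen-compl
  ; union      = gen-union
  }

data Ray : Pred (Pred ℝ≥0∞ 0ℓ) (lsuc 0ℓ) where
  ray : ∀ r → Ray (r <ʳ_)

Borel : MeasurableSpace (lsuc 0ℓ) (lsuc 0ℓ)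
Borel = generate Ray

IsMeasurable : (M : MeasurableSpace a m₁) (N : MeasurableSpace b m₂) →
               (Carrier M → Carrier N) → Set _
IsMeasurable M N f = ∀ B → Measurable N B → Measurable M (f ⊢ B)

record MeasurableMap (M : MeasurableSpace a m₁) (N : MeasurableSpace b m₂) :
                     Set (a ⊔ b ⊔ m₁ ⊔ m₂ ⊔ lsuc 0ℓ) where
  field
    fun            : Carrier M → Carrier N
    fun-measurable : IsMeasurable M N fun

open MeasurableMap public

preimage : {M : MeasurableSpace a m₁} {N : MeasurableSpace b m₂} →
           MeasurableMap M N → Event N → Event M
preimage f B = event (fun f ⊢ set B) (fun-measurable f (set B) (measurable B))

SetFunction : MeasurableSpace a m → Set (a ⊔ m ⊔ lsuc 0ℓ)
SetFunction M = Event M → ℝ≥0∞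

record Dist (M : MeasurableSpace a m) : Set (a ⊔ m ⊔ lsuc 0ℓ) where
  field
    measure  : SetFunction M
    respects : ∀ A B → set A ≐ set B → measure A ≈ measure B
    null     : measure ∅ᵉ ≈ 0ʳ
    additive : ∀ A → (∀ i j → i ≢ j → set (A i) ⊥ set (A j)) →
               measure (⋃ᵉ A) ≈ ∑ (measure ∘ A)
    total    : measure Uᵉ ≈ 1ʳ

open Dist public

module _ {M : MeasurableSpace a m} where

  SameNullSets : SetFunction M → SetFunction M → Set (a ⊔ m ⊔ lsuc 0ℓ)
  SameNullSets μ ν = ∀ A → μ A ≈ 0ʳ ⇔ ν A ≈ 0ʳ

pushforward : {M : MeasurableSpace a m₁} {N : MeasurableSpace b m₂} →
              MeasurableMap M N → SetFunction M → SetFunction N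
pushforward f μ = μ ∘ preimage f

_#_ : {M : MeasurableSpace a m₁} {N : MeasurableSpace b m₂} →
      MeasurableMap M N → Dist M → Dist N
f # μ = record
  { measure  = pushforward f (measure μ)
  ; respects = λ A B (A⊆B , B⊆A) →
      respects μ (preimage f A) (preimage f B) (A⊆B , B⊆A)
  ; null     = ≈-trans (respects μ (preimage f ∅ᵉ) ∅ᵉ (id , id)) (null μ)
  ; additive = λ A disj →
      ≈-trans (respects μ (preimage f (⋃ᵉ A)) (⋃ᵉ (preimage f ∘ A)) (id , id))
              (additive μ (preimage f ∘ A) λ i j i≢j → disj i j i≢j)
  ; total    = ≈-trans (respects μ (preimage f Uᵉ) Uᵉ (id , id)) (total μ)
  }

dirac : (M : MeasurableSpace a m) → Carrier M → Dist M
dirac M s = record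
  { measure  = measureₛ
  ; respects = λ A B (A⊆B , B⊆A) → mono A⊆B , mono B⊆A
  ; null     = zero-intro λ { (inj₁ q<0) → q<0 }
  ; additive = λ A disj →
      (λ where
        (inj₁ q<0) → 0 , inj₁ q<0
        (inj₂ ((n , s∈) , q<1)) → term≤∑ (measureₛ ∘ A) n (inj₂ (s∈ , q<1))) ,
      (λ (n , q∈) → mono (λ (i , _ , s∈) → i , s∈) (finite A disj n q∈))
  ; total    = (λ { (inj₁ q<0) → inj₁ q<0 ; (inj₂ (_ , q<1)) → q<1 }) ,
               (λ q<1 → inj₂ (tt , q<1))
  }
  where
  measureₛ : SetFunction M
  measureₛ A = 1ʳ when (s ∈ set A)

  mono : ∀ {P Q : Set} → (P → Q) → 1ʳ when P ≤ʳ 1ʳ when Q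
  mono f (inj₁ q<0)       = inj₁ q<0
  mono f (inj₂ (p , q<1)) = inj₂ (f p , q<1)

  <1 : ∀ {q} → q ∈ cut 1ʳ → q < 1ℚ
  <1 (inj₁ q<0) = ℚ.<-trans q<0 (ℚ.positive⁻¹ 1ℚ)
  <1 (inj₂ q<1) = q<1

  finite : ∀ (A : ℕ → Event M) →
           (∀ i j → i ≢ j → set (A i) ⊥ set (A j)) → ∀ n →
           partialSum (measureₛ ∘ A) n ≤ʳ
           1ʳ when (∃ λ i → i ℕ.< n × s ∈ set (A i))
  finite A disj zero    (inj₁ q<0) = inj₁ q<0
  finite A disj zero    (inj₂ q<0) = inj₁ q<0
  finite A disj (suc n) (x , y , x∈ , y∈ , q≤) with finite A disj n x∈ | y∈
  ... | inj₁ x<0 | inj₁ y<0 = inj₁ (ℚ.≤-<-trans q≤ (ℚ.+-mono-< x<0 y<0))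
  ... | inj₁ x<0 | inj₂ (s∈ , y<1) =
    inj₂ ((n , ℕ.≤-refl , s∈) , inj₂ (ℚ.≤-<-trans q≤ (ℚ.+-mono-< x<0 (<1 y<1))))
  ... | inj₂ ((i , i<n , s∈) , x<1) | inj₁ y<0 =
    inj₂ ((i , ℕ.m≤n⇒m≤1+n i<n , s∈) ,
          inj₂ (ℚ.≤-<-trans q≤ (ℚ.+-mono-< (<1 x<1) y<0)))
  ... | inj₂ ((i , i<n , s∈i) , _) | inj₂ (s∈n , _) =
    ⊥-elim (disj i n (ℕ.<⇒≢ i<n) (s∈i , s∈n))

record STS (a m : Level) : Set (lsuc (a ⊔ m ⊔ lsuc 0ℓ)) where
  field
    space        : MeasurableSpace a m
    κ            : Carrier space → Dist space
    κ-measurable : ∀ A → IsMeasurable space Borel (λ s → measure (κ s) A)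

open STS public

State : STS a m → Set a
State T = Carrier (space T)

module _ (M : MeasurableSpace a m) where

  Path : Set a
  Path = ℕ → Carrier M

  -- The cylinder A₀ × … × Aₙ × S × S × …
  cylinder : ℕ → (ℕ → Event M) → Pred Path 0ℓ
  cylinder n A ω = ∀ i → i ℕ.≤ n → ω i ∈ set (A i)

  data Cylinder : Pred (Pred Path 0ℓ) (a ⊔ m ⊔ lsuc 0ℓ) where
    cyl : ∀ n A → Cylinder (cylinder n A)

  pathSpace : MeasurableSpace a (lsuc 0ℓ ⊔ a ⊔ m)
  pathSpace = generate Cylinder

  Cyl : ℕ → (ℕ → Event M) → Event pathSpace
  Cyl n A = event (cylinder n A) (gen (cyl n A))

  -- S, …, S, B, B, … with the first B at index n.
  only : ℕ → Event M → ℕ → Event M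
  only zero    B _       = B
  only (suc n) B zero    = Uᵉ
  only (suc n) B (suc i) = only n B i

  only-diag : ∀ n B → only n B n ≡ B
  only-diag zero    B = refl
  only-diag (suc n) B = only-diag n B

  only-off : ∀ n B {i x} → i ℕ.< n → x ∈ set (only n B i)
  only-off (suc n) B {zero}  _   = tt
  only-off (suc n) B {suc i} i<n = only-off n B (ℕ.s<s⁻¹ i<n)

  At-cylinder : ∀ n B → cylinder n (only n B) ≐ (λ ω → ω n ∈ set B)
  At-cylinder n B =
    (λ {ω} h → subst (λ C → ω n ∈ set C) (only-diag n B) (h n ℕ.≤-refl)) ,
    (λ {ω} h i i≤n → from ω h i (ℕ.m≤n⇒m<n∨m≡n i≤n))
    where
    from : ∀ ω → ω n ∈ set B → ∀ i → i ℕ.< n ⊎ i ≡ n → ω i ∈ set (only n B i)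
    from ω h i (inj₁ i<n)  = only-off n B i<n
    from ω h i (inj₂ refl) = subst (λ C → ω n ∈ set C) (sym (only-diag n B)) h

  At : ℕ → Event M → Event pathSpace
  At n B = event (λ ω → ω n ∈ set B)
                 (gen-resp (At-cylinder n B) (gen (cyl n (only n B))))

  -- Eventually B.
  F : Event M → Event pathSpace
  F B = ⋃ᵉ λ n → At n B

module Classical (em : ∀ {ℓ} → ExcludedMiddle ℓ) where

  -- Propositional resizing: needed because the supremum defining the
  -- integral ranges over a large type.
  Small : ∀ {ℓ} → Set ℓ → Set
  Small P = True (em {P = P})

  small : ∀ {ℓ} {P : Set ℓ} → P → Small P
  small {P = P} = fromWitness {a? = em {P = P}}

  unsmall : ∀ {ℓ} {P : Set ℓ} → Small P → P
  unsmall {P = P} = toWitness {a? = em {P = P}}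

  -- The simple function ∑ᵢ cᵢ 1_{Aᵢ}.
  Simple : MeasurableSpace a m → Set _
  Simple M = List (ℝ≥0∞ × Event M)

  module _ {M : MeasurableSpace a m} where

    eval : Simple M → Carrier M → ℝ≥0∞
    eval []            x = 0ʳ
    eval ((c , A) ∷ g) x = (c when (x ∈ set A)) +ʳ eval g x

    simple∫ : Simple M → Dist M → ℝ≥0∞
    simple∫ []            μ = 0ʳ
    simple∫ ((c , A) ∷ g) μ = (c *ʳ measure μ A) +ʳ simple∫ g μ

    -- The Lebesgue integral: the supremum of simple∫ g over simple g ≤ f.
    ∫ : (Carrier M → ℝ≥0∞) → Dist M → ℝ≥0∞
    ∫ f μ = record
      { cut      = λ q → Small (Below q)
      ; negative = λ q<0 → small ([] , (λ x {p} → zero≤ x {p}) , inj₁ q<0)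
      ; down     = λ p<q q∈ → let g , g≤f , q∈g = unsmall q∈ in
          small (g , g≤f , down (simple∫ g μ) p<q q∈g)
      ; open′    = λ q∈ →
          let g , g≤f , q∈g = unsmall q∈
              p , q<p , p∈g = open′ (simple∫ g μ) q∈g
          in p , q<p , small (g , g≤f , p∈g)
      }
      where
      Below : ℚ → Set _
      Below q = Σ (Simple M) λ g →
        (∀ x → eval g x ≤ʳ f x) × q ∈ cut (simple∫ g μ)
      zero≤ : ∀ x → 0ʳ ≤ʳ f x
      zero≤ x (inj₁ q<0) = negative (f x) q<0
      zero≤ x (inj₂ q<0) = negative (f x) q<0

  -- Ω T μ is again a probability measure, but only its values are used.
  Ω : (T : STS a m) → Dist (space T) → SetFunction (space T)
  Ω T μ A = ∫ (λ s → measure (κ T s) A) μ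

  -- P is the law of the Markov chain with kernel κ and initial distribution
  -- μ: for all n and A₀, …, Aₙ₊₁,
  --   P(s₀ ∈ A₀) = μ(A₀)  and
  --   P(s₀ ∈ A₀, …, sₙ₊₁ ∈ Aₙ₊₁) = ∫_{s₀ ∈ A₀, …, sₙ ∈ Aₙ} κ(sₙ, Aₙ₊₁) dP.
  record IsPathLaw (T : STS a m) (μ : Dist (space T))
                   (P : Dist (pathSpace (space T))) : Set (a ⊔ m ⊔ lsuc 0ℓ) where
    field
      initial : ∀ A → measure P (Cyl (space T) 0 A) ≈ measure μ (A 0)
      step    : ∀ n A → measure P (Cyl (space T) (suc n) A) ≈
                ∫ (λ ω → measure (κ T (ω n)) (A (suc n))
                           when (ω ∈ cylinder (space T) n A)) P

  open IsPathLaw public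

  -- Prob sends each μ to the law of the chain started from μ.  That law is
  -- unique (cylinders form a π-system) and exists (Ionescu-Tulcea); its
  -- existence is carried as data rather than constructed.
  record PathLaws (T : STS a m) : Set (a ⊔ m ⊔ lsuc 0ℓ) where
    field
      Prob      : Dist (space T) → Dist (pathSpace (space T))
      isPathLaw : ∀ μ → IsPathLaw T μ (Prob μ)

  open PathLaws public

  module _ {M : MeasurableSpace a m} where

    infixr 7 _∩ᵉ_

    _∩ᵉ_ : Event M → Event M → Event M
    A ∩ᵉ B = event (set A ∩ set B)
                   (resp M (to , from) (measurable (∁ᵉ (∁ᵉ A ∪ᵉ ∁ᵉ B))))
      where
      by-contradiction : ∀ {P : Set} → ¬ ¬ P → P
      by-contradiction {P} ¬¬p with em {P = P}
      ... | yes p = p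
      ... | no ¬p = ⊥-elim (¬¬p ¬p)
      to : set (∁ᵉ (∁ᵉ A ∪ᵉ ∁ᵉ B)) ⊆ set A ∩ set B
      to h = by-contradiction (h ∘ inj₁) , by-contradiction (h ∘ inj₂)
      from : set A ∩ set B ⊆ set (∁ᵉ (∁ᵉ A ∪ᵉ ∁ᵉ B))
      from (x∈A , x∈B) = [ (λ x∉A → x∉A x∈A) , (λ x∉B → x∉B x∈B) ]′

    module _ (μ : Dist M) where

      null-⊆ : ∀ A B → set A ⊆ set B → measure μ B ≈ 0ʳ → measure μ A ≈ 0ʳ
      null-⊆ A B A⊆B = ≤-zero λ q∈ →
        ≤-incl (respects μ (⋃ᵉ D) B (to , from))
          (≥-incl (additive μ D disjoint) (term≤∑ (measure μ ∘ D) 0 q∈))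
        where
        D : ℕ → Event M
        D zero          = A
        D (suc zero)    = B ∩ᵉ ∁ᵉ A
        D (suc (suc _)) = ∅ᵉ
        disjoint : ∀ i j → i ≢ j → set (D i) ⊥ set (D j)
        disjoint zero zero i≢j _ = i≢j refl
        disjoint zero (suc zero) _ (x∈A , _ , x∉A) = x∉A x∈A
        disjoint (suc zero) zero _ ((_ , x∉A) , x∈A) = x∉A x∈A
        disjoint (suc zero) (suc zero) i≢j _ = i≢j refl
        to : set (⋃ᵉ D) ⊆ set B
        to (zero , x∈A)           = A⊆B x∈A
        to (suc zero , x∈B , _)   = x∈B
        from : set B ⊆ set (⋃ᵉ D)
        from {x} x∈B with em {P = x ∈ set A}
        ... | yes x∈A = 0 , x∈A
        ... | no  x∉A = 1 , x∈B , x∉A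

      null-⋃ : ∀ B → (∀ n → measure μ (B n) ≈ 0ʳ) → measure μ (⋃ᵉ B) ≈ 0ʳ
      null-⋃ B B-null = null-⊆ (⋃ᵉ B) (⋃ᵉ D) ⋃B⊆⋃D
        (≈-trans (additive μ D disjoint)
          (∑-zero λ n → null-⊆ (D n) (B n) proj₁ (B-null n)))
        where
        -- E n is the union of the B i with i < n.
        E D : ℕ → Event M
        E zero    = ∅ᵉ
        E (suc n) = E n ∪ᵉ B n
        D n = B n ∩ᵉ ∁ᵉ (E n)
        below : ∀ {x} i j → i ℕ.< j → x ∈ set (B i) → x ∈ set (E j)
        below i (suc j) i<1+j x∈ with ℕ.m≤n⇒m<n∨m≡n (ℕ.s≤s⁻¹ i<1+j)
        ... | inj₁ i<j  = inj₁ (below i j i<j x∈)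
        ... | inj₂ refl = inj₂ x∈
        disjoint : ∀ i j → i ≢ j → set (D i) ⊥ set (D j)
        disjoint i j i≢j ((x∈i , x∉i) , (x∈j , x∉j)) with ℕ.<-cmp i j
        ... | tri< i<j _ _ = x∉j (below i j i<j x∈i)
        ... | tri≈ _ i≡j _ = i≢j i≡j
        ... | tri> _ _ j<i = x∉i (below j i j<i x∈j)
        E⊆⋃D : ∀ n → set (E n) ⊆ set (⋃ᵉ D)
        E⊆⋃D (suc n)     (inj₁ x∈) = E⊆⋃D n x∈
        E⊆⋃D (suc n) {x} (inj₂ x∈) with em {P = x ∈ set (E n)}
        ... | yes x∈E = E⊆⋃D n x∈E
        ... | no  x∉E = n , x∈ , x∉E
        ⋃B⊆⋃D : set (⋃ᵉ B) ⊆ set (⋃ᵉ D)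
        ⋃B⊆⋃D (n , x∈) = E⊆⋃D (suc n) (inj₂ x∈)

      -- ∫ f dμ = 0 iff f vanishes μ-almost everywhere.
      module _ (f : Carrier M → ℝ≥0∞)
               (f-meas : ∀ r → Measurable M (λ x → r <ʳ f x)) where

        Above : ℝ≥0∞ → Event M
        Above r = event (λ x → r <ʳ f x) (f-meas r)

        ∫-zero⇒ : ∫ f μ ≈ 0ʳ → measure μ (Above 0ʳ) ≈ 0ʳ
        ∫-zero⇒ ∫≈0 = null-⊆ (Above 0ʳ) (⋃ᵉ level) cover (null-⋃ level level-null)
          where
          level : ℕ → Event M
          level n = Above (fromℚ (ε n))
          cover : set (Above 0ʳ) ⊆ set (⋃ᵉ level)
          cover {x} (q , q∈ , q∉0) =
            let p , q<p , p∈ = open′ (f x) q∈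
                0<p = ℚ.≤-<-trans (ℚ.≮⇒≥ (q∉0 ∘ inj₁)) q<p
                n , ε≤p = archimedean p 0<p
            in n , p , p∈ , λ where
                 (inj₁ p<0) → ℚ.<-irrefl refl (ℚ.<-trans p<0 0<p)
                 (inj₂ p<ε) → ℚ.<-irrefl refl (ℚ.<-≤-trans p<ε ε≤p)
          simple : ℕ → Simple M
          simple n = (fromℚ (ε n) , level n) ∷ []
          simple≤f : ∀ n x → eval (simple n) x ≤ʳ f x
          simple≤f n x {q} (c , z , c∈ , z∈ , q≤) = go c∈
            where
            q<c : q < c
            q<c = ℚ.≤-<-trans q≤ (subst (c + z <_) (ℚ.+-identityʳ c)
                    (ℚ.+-monoʳ-< c ([ id , id ]′ z∈)))
            go : c ∈ cut (fromℚ (ε n) when (x ∈ set (level n))) → q ∈ cut (f x)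
            go (inj₁ c<0) = negative (f x) (ℚ.<-trans q<c c<0)
            go (inj₂ (_ , inj₁ c<0)) = negative (f x) (ℚ.<-trans q<c c<0)
            go (inj₂ ((p , p∈ , p∉ε) , inj₂ c<ε)) =
              down (f x) (ℚ.<-≤-trans (ℚ.<-trans q<c c<ε) (ℚ.≮⇒≥ (p∉ε ∘ inj₂))) p∈
          level-null : ∀ n → measure μ (level n) ≈ 0ʳ
          level-null n = *-cancel-zero n (≤-zero
            (λ q∈ → small (simple n , (λ x {q} → simple≤f n x {q}) ,
               +-incl₁ (fromℚ (ε n) *ʳ measure μ (level n)) {0ʳ} q∈)) ∫≈0)

        ∫-zero⇐ : measure μ (Above 0ʳ) ≈ 0ʳ → ∫ f μ ≈ 0ʳ
        ∫-zero⇐ f-null = zero-intro λ q∈ →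
          let g , g≤f , q∈g = unsmall q∈
          in zero-elim (simple-null g (λ x {q} → g≤f x {q})) q∈g
          where
          term-null : ∀ c (A : Event M) →
            (∀ x → x ∈ set A → c ≤ʳ f x) → c *ʳ measure μ A ≈ 0ʳ
          term-null c A c≤f with em {P = 0ʳ <ʳ c}
          ... | yes (p , p∈c , p∉0) =
            *-zeroʳ {x = c} (null-⊆ A (Above 0ʳ)
              (λ {x} x∈A → p , c≤f x x∈A p∈c , p∉0) f-null)
          ... | no 0≮c = *-zeroˡ (zero-intro λ {q} q∈ → neg q q∈ (q ℚ.<? 0ℚ))
            where
            neg : ∀ q → q ∈ cut c → Dec (q < 0ℚ) → q < 0ℚ
            neg q q∈ (yes q<0) = q<0
            neg q q∈ (no  q≮0) = ⊥-elim (0≮c (q , q∈ , [ q≮0 , q≮0 ]′))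
          simple-null : ∀ g → (∀ x → eval g x ≤ʳ f x) → simple∫ g μ ≈ 0ʳ
          simple-null []            _   = id , id
          simple-null ((c , A) ∷ g) g≤f = +-zero
            (term-null c A λ x x∈A q∈ → g≤f x
              (+-incl₁ (c when (x ∈ set A)) {eval g x} (inj₂ (x∈A , q∈))))
            (simple-null g λ x q∈ → g≤f x
              (+-incl₂ (c when (x ∈ set A)) {eval g x} q∈))

  -- The states from which B is reached in one step with positive probability.
  Pre : (T : STS a m) → Event (space T) → Event (space T)
  Pre T B = event (λ s → 0ʳ <ʳ measure (κ T s) B)
                  (κ-measurable T B _ (gen (ray 0ʳ)))

  -- The states from which B is reached in n steps with positive probability.
  Reach : (T : STS a m) → ℕ → Event (space T) → Event (space T)
  Reach T zero    B = B
  Reach T (suc n) B = Reach T n (Pre T B)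

  module _ {T : STS a m} {μ : Dist (space T)} {P : Dist (pathSpace (space T))}
           (law : IsPathLaw T μ P) where

    private M = space T

    At-zero : ∀ B → measure P (At M 0 B) ≈ measure μ B
    At-zero B = ≈-trans
      (respects P (At M 0 B) (Cyl M 0 λ _ → B)
        ((λ { h zero _ → h }) , (λ h → h 0 ℕ.z≤n)))
      (initial law λ _ → B)

    At-suc : ∀ n B →
             measure P (At M (suc n) B) ≈ 0ʳ ⇔ measure P (At M n (Pre T B)) ≈ 0ʳ
    At-suc n B = mk⇔
      (λ h → ≈-trans (respects P (At M n (Pre T B)) (Above P f f-meas 0ʳ) (to 0ʳ , from 0ʳ))
                     (∫-zero⇒ P f f-meas (≈-trans (≈-sym eq) h)))
      (λ h → ≈-trans eq (∫-zero⇐ P f f-meas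
               (≈-trans (respects P (Above P f f-meas 0ʳ) (At M n (Pre T B)) (from 0ʳ , to 0ʳ))
                        h)))
      where
      A = only M (suc n) B
      f : Path M → ℝ≥0∞
      f ω = measure (κ T (ω n)) (A (suc n)) when (ω ∈ cylinder M n A)
      to : ∀ r {ω} → r <ʳ measure (κ T (ω n)) B → r <ʳ f ω
      to r {ω} (q , q∈ , q∉r) = q ,
        inj₂ ((λ i i≤n → only-off M (suc n) B (ℕ.s≤s i≤n)) ,
              subst (λ C → q ∈ cut (measure (κ T (ω n)) C)) (sym (only-diag M (suc n) B)) q∈) ,
        q∉r
      from : ∀ r {ω} → r <ʳ f ω → r <ʳ measure (κ T (ω n)) B
      from r {ω} (q , inj₁ q<0 , q∉r) = ⊥-elim (q∉r (negative r q<0))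
      from r {ω} (q , inj₂ (_ , q∈) , q∉r) = q ,
        subst (λ C → q ∈ cut (measure (κ T (ω n)) C)) (only-diag M (suc n) B) q∈ , q∉r
      f-meas : ∀ r → Measurable (pathSpace M) (λ ω → r <ʳ f ω)
      f-meas r = gen-resp (to r , from r)
        (measurable (At M n (event _ (κ-measurable T B _ (gen (ray r))))))
      eq : measure P (At M (suc n) B) ≈ ∫ f P
      eq = ≈-trans
        (respects P (At M (suc n) B) (Cyl M (suc n) A) (swap (At-cylinder M (suc n) B)))
        (step law n A)

    F-null : ∀ B → measure P (F M B) ≈ 0ʳ ⇔ (∀ n → measure P (At M n B) ≈ 0ʳ)
    F-null B = mk⇔ (λ h n → null-⊆ P (At M n B) (F M B) (λ x∈ → n , x∈) h)
                   (null-⋃ P (λ n → At M n B))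

  module _ {T : STS a m} (L : PathLaws T) where

    private M = space T

    avoid : Event M → Pred (State T) 0ℓ
    avoid B s = measure (Prob L (dirac M s)) (F M B) ≈ 0ʳ

    avoid-Reach : ∀ B → avoid B ≐ set (∁ᵉ (⋃ᵉ λ n → Reach T n B))
    avoid-Reach B =
      (λ {s} h (n , s∈) → At⇒ n B (Equivalence.to (F-null (law s) B) h n) s∈) ,
      (λ {s} h → Equivalence.from (F-null (law s) B) λ n → At⇐ n B λ s∈ → h (n , s∈))
      where
      P : State T → Dist (pathSpace M)
      P s = Prob L (dirac M s)
      law : ∀ s → IsPathLaw T (dirac M s) (P s)
      law s = isPathLaw L (dirac M s)
      At⇒ : ∀ n B {s} → measure (P s) (At M n B) ≈ 0ʳ → s ∉ set (Reach T n B)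
      At⇒ zero B {s} h s∈B = ℚ.<-irrefl refl
        (zero-elim (≈-trans (≈-sym (At-zero (law s) B)) h) {0ℚ}
          (inj₂ (s∈B , inj₂ (ℚ.positive⁻¹ 1ℚ))))
      At⇒ (suc n) B {s} h =
        At⇒ n (Pre T B) (Equivalence.to (At-suc (law s) n B) h)
      At⇐ : ∀ n B {s} → s ∉ set (Reach T n B) → measure (P s) (At M n B) ≈ 0ʳ
      At⇐ zero B {s} s∉B = ≈-trans (At-zero (law s) B)
        (zero-intro [ id , (λ (s∈B , _) → ⊥-elim (s∉B s∈B)) ]′)
      At⇐ (suc n) B {s} h =
        Equivalence.from (At-suc (law s) n B) (At⇐ n (Pre T B) h)

    avoid-measurable : ∀ B → Measurable M (avoid B)
    avoid-measurable B = resp M (swap (avoid-Reach B))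
                                (compl M (measurable (⋃ᵉ λ n → Reach T n B)))

    Avoid : Event M → Event M
    Avoid B = event (avoid B) (avoid-measurable B)

    Decisive : Event M → Dist M → Set
    Decisive B μ = measure (Prob L μ) (F M B ∪ᵉ F M (Avoid B)) ≈ 1ʳ

  IsAbstraction : (T₁ : STS a m₁) (T₂ : STS b m₂) →
                  MeasurableMap (space T₁) (space T₂) → Set (a ⊔ b ⊔ m₁ ⊔ m₂ ⊔ lsuc 0ℓ)
  IsAbstraction T₁ T₂ α =
    ∀ μ → SameNullSets (pushforward α (Ω T₁ μ)) (Ω T₂ (α # μ))

  IsSound : {T₁ : STS a m₁} {T₂ : STS b m₂} → PathLaws T₁ → PathLaws T₂ →
            MeasurableMap (space T₁) (space T₂) → Dist (space T₁) →
            Set (b ⊔ m₂ ⊔ lsuc 0ℓ)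
  IsSound {T₁ = T₁} {T₂ = T₂} L₁ L₂ α μ = ∀ B →
    measure (Prob L₂ (α # μ)) (F (space T₂) B) ≈ 1ʳ →
    measure (Prob L₁ μ) (F (space T₁) (preimage α B)) ≈ 1ʳ

-- By the abstraction property at Dirac measures, a state s can enter α⁻¹(B)
-- in one step iff α(s) can enter B in one step.  By iteration, reachability,
-- hence also the avoid-set, commutes with α⁻¹.  Decisiveness is almost sure
-- reachability of B ∪ B̃, which soundness transfers.
{-# OPTIONS --safe #-}
module Submission where

open import Defs
open import Axiom.DoubleNegationElimination using (em⇒dne)
open import Axiom.ExcludedMiddle using (ExcludedMiddle)
open import Data.Nat.Base using (ℕ; zero; suc)
open import Data.Product.Base using (_,_; map₂; proj₁; proj₂)
open import Data.Rational.Base using (1ℚ)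
import Data.Rational.Properties as ℚ
open import Data.Sum.Base using (inj₁; inj₂; [_,_]′)
open import Function.Base using (_∘_; id)
open import Function.Bundles using (_⇔_; mk⇔; module Equivalence)
open import Function.Construct.Composition using (_⇔-∘_)
open import Function.Construct.Symmetry using (⇔-sym)
open import Level using (Level)
open import Relation.Binary.PropositionalEquality.Core using (refl)
open import Relation.Nullary using (contradiction)
open import Relation.Unary using (_∉_; _⊆_; _≐_; _⊢_)

private variable
  a b m m₁ m₂ : Level

dirac-null : (M : MeasurableSpace a m) (s : Carrier M) (A : Event M) →
             measure (dirac M s) A ≈ 0ʳ ⇔ s ∉ set A
dirac-null M s A = mk⇔
  -- The witness is the rational 0: it lies in the cut of 1 but not in the cut of 0.
  (λ null s∈A → ℚ.<-irrefl refl
    (zero-elim null (inj₂ (s∈A , inj₂ (ℚ.positive⁻¹ 1ℚ)))))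
  (λ s∉A → zero-intro [ id , (λ (s∈A , _) → contradiction s∈A s∉A) ]′)

F-cong : (M : MeasurableSpace a m) (P : Dist (pathSpace M)) (A B : Event M) →
         set A ≐ set B → measure P (F M A) ≈ measure P (F M B)
F-cong M P A B (A⊆B , B⊆A) = respects P (F M A) (F M B) (map₂ A⊆B , map₂ B⊆A)

-- Turns the event of decisiveness into reachability of a single set, the form that soundness speaks
-- about.
F-∪ : (M : MeasurableSpace a m) (P : Dist (pathSpace M)) (A B : Event M) →
      measure P (F M A ∪ᵉ F M B) ≈ measure P (F M (A ∪ᵉ B))
F-∪ M P A B = respects P (F M A ∪ᵉ F M B) (F M (A ∪ᵉ B))
  ( [ map₂ inj₁ , map₂ inj₂ ]′
  , λ (n , h) → [ inj₁ ∘ (n ,_) , inj₂ ∘ (n ,_) ]′ h)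

module _ (em : ∀ {ℓ} → ExcludedMiddle ℓ) where
  open Classical em

  -- A nonnegative function has integral 0 iff it vanishes almost everywhere, and `Pre T B` is
  -- exactly where the integrand is positive.
  Ω-null : (T : STS a m) (μ : Dist (space T)) (B : Event (space T)) →
           Ω T μ B ≈ 0ʳ ⇔ measure μ (Pre T B) ≈ 0ʳ
  Ω-null T μ B = mk⇔ (∫-zero⇒ μ f f-meas) (∫-zero⇐ μ f f-meas)
    where
    f : State T → ℝ≥0∞
    f s = measure (κ T s) B
    f-meas : ∀ r → Measurable (space T) (λ s → r <ʳ f s)
    f-meas r = κ-measurable T B _ (gen (ray r))

  -- Events with equal sets may carry different measurability proofs, so rewriting the target needs
  -- `respects` for each kernel measure; it takes both inclusions, hence `≐` in the hypothesis.
  Reach-mono : (T : STS a m) (n : ℕ) (A B : Event (space T)) →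
               set A ≐ set B → set (Reach T n A) ⊆ set (Reach T n B)
  Reach-mono T zero    A B (A⊆B , _) = A⊆B
  Reach-mono T (suc n) A B (A⊆B , B⊆A) = Reach-mono T n (Pre T A) (Pre T B)
    ( (λ {s} → map₂ λ (q∈ , q∉) → ≤-incl (respects (κ T s) A B (A⊆B , B⊆A)) q∈ , q∉)
    , (λ {s} → map₂ λ (q∈ , q∉) → ≥-incl (respects (κ T s) A B (A⊆B , B⊆A)) q∈ , q∉))

  module _ (T₁ : STS a m₁) (T₂ : STS b m₂)
           (α : MeasurableMap (space T₁) (space T₂))
           (abs : IsAbstraction T₁ T₂ α) where

    Pre-preimage : ∀ B → set (Pre T₁ (preimage α B)) ≐ fun α ⊢ set (Pre T₂ B)
    Pre-preimage B =
      -- Null sets only tell when a state lies outside an event, so membership is recovered from the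
      -- complements.
      (λ {s} p → em⇒dne em λ ¬p → Equivalence.from (unreachable s) ¬p p) ,
      (λ {s} p → em⇒dne em λ ¬p → Equivalence.to (unreachable s) ¬p p)
      where
      unreachable : ∀ s → s ∉ set (Pre T₁ (preimage α B)) ⇔
                          s ∉ set (preimage α (Pre T₂ B))
      unreachable s =
        -- Read from the last link upwards. The links meet because `α # δₛ` at `Pre T₂ B` is by
        -- definition `δₛ` at its preimage.
        dirac-null (space T₁) s (preimage α (Pre T₂ B)) ⇔-∘
        (Ω-null T₂ (α # δₛ) B ⇔-∘
        (abs δₛ B ⇔-∘
        (⇔-sym (Ω-null T₁ δₛ (preimage α B)) ⇔-∘
        ⇔-sym (dirac-null (space T₁) s (Pre T₁ (preimage α B))))))
        where
        δₛ : Dist (space T₁)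
        δₛ = dirac (space T₁) s

    Reach-preimage : ∀ n B →
                     set (Reach T₁ n (preimage α B)) ≐ fun α ⊢ set (Reach T₂ n B)
    Reach-preimage zero    B = id , id
    Reach-preimage (suc n) B =
      -- `Reach` recurses by enlarging the target, so the induction hypothesis is taken at
      -- `Pre T₂ B` instead of `B`.
      let to , from = Reach-preimage n (Pre T₂ B)
          Pre⊆ , Pre⊇ = Pre-preimage B
          A = Pre T₁ (preimage α B)
          C = preimage α (Pre T₂ B)
      in to ∘ Reach-mono T₁ n A C (Pre⊆ , Pre⊇) ,
         Reach-mono T₁ n C A (Pre⊇ , Pre⊆) ∘ from

    -- `avoid-Reach` replaces path probabilities by the sets `Reach`, to which `Reach-preimage`
    -- applies for each number of steps.
    avoid-preimage : (L₁ : PathLaws T₁) (L₂ : PathLaws T₂) → ∀ B →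
                     fun α ⊢ avoid L₂ B ≐ avoid L₁ (preimage α B)
    avoid-preimage L₁ L₂ B =
      (λ s∈ → proj₂ (avoid-Reach L₁ (preimage α B)) λ (n , r) →
        proj₁ (avoid-Reach L₂ B) s∈ (n , proj₁ (Reach-preimage n B) r)) ,
      (λ s∈ → proj₂ (avoid-Reach L₂ B) λ (n , r) →
        proj₁ (avoid-Reach L₁ (preimage α B)) s∈ (n , proj₂ (Reach-preimage n B) r))

proposition33 : (em : ∀ {ℓ} → ExcludedMiddle ℓ) → let open Classical em in
    ∀ {a b m₁ m₂} (T₁ : STS a m₁) (T₂ : STS b m₂)
    (L₁ : PathLaws T₁) (L₂ : PathLaws T₂)
    (α : MeasurableMap (space T₁) (space T₂)) (μ : Dist (space T₁)) →
    IsAbstraction T₁ T₂ α → IsSound L₁ L₂ α μ →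
    (B : Event (space T₂)) →
    Decisive L₂ B (α # μ) → Decisive L₁ (preimage α B) μ
proposition33 em T₁ T₂ L₁ L₂ α μ abs sound B decisive =
  ≈-trans (F-∪ (space T₁) (Prob L₁ μ) (preimage α B) (Avoid L₁ (preimage α B)))
  -- Soundness yields the preimage of the avoid-set in `T₂`; the goal has the avoid-set of the
  -- preimage in `T₁`.
  (≈-trans (F-cong (space T₁) (Prob L₁ μ)
             (preimage α B ∪ᵉ Avoid L₁ (preimage α B)) (preimage α (B ∪ᵉ Avoid L₂ B))
             ([ inj₁ , inj₂ ∘ avoid⊇ ]′ , [ inj₁ , inj₂ ∘ avoid⊆ ]′))
  (sound (B ∪ᵉ Avoid L₂ B)
  (≈-trans (≈-sym (F-∪ (space T₂) (Prob L₂ (α # μ)) B (Avoid L₂ B)))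
  decisive)))
  where
  open Classical em
  avoid⊆ : fun α ⊢ avoid L₂ B ⊆ avoid L₁ (preimage α B)
  avoid⊆ = proj₁ (avoid-preimage em T₁ T₂ α abs L₁ L₂ B)
  avoid⊇ : avoid L₁ (preimage α B) ⊆ fun α ⊢ avoid L₂ B
  avoid⊇ = proj₂ (avoid-preimage em T₁ T₂ α abs L₁ L₂ B)
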